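{- Assume the setting described in the context, and let $\langle e^m_\alpha:\alpha<\lambda,m<\omega\rangle$ be a generalized $C$-sequence on $\lambda$ such that for all $\alpha<\lambda$ and $m<\omega$: $|e^m_\alpha|\leq\mathrm{cf}(\alpha)+\mu_m^+$, and if $\delta\in S\cap e^m_\alpha$ then $C_\delta[m]\subseteq e^m_\alpha$. Let $\langle t_\alpha:\alpha<\lambda\rangle$ be a pairwise disjoint family of finite subsets of $\lambda$. Then for $\mathrm{id}_p(\bar C,\bar I)$-almost all $\beta^*<\lambda$ (that is, the set of $\beta^*<\lambda$ for which the following fails belongs to $\mathrm{id}_p(\bar C,\bar I)$) there are $\alpha<\beta<\lambda$ and $m<\omega$ such that for every $\zeta\in t_\alpha$ and $\xi\in t_\beta$, the $m$-walk from $\xi$ to $\zeta$ passes through $\beta^*$, i.e. $\beta^*=\beta^m_k(\zeta,\xi)$ for some $k$.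
   Context: Setting: $\mu$ is a singular cardinal with $\mathrm{cf}(\mu)=\aleph_0$, $\lambda=\mu^+$, $\sigma$ is a regular cardinal with $\aleph_0<\sigma<\mu$, $S$ is a stationary subset of $\{\delta<\lambda:\mathrm{cf}(\delta)=\sigma\}$, and $\langle\mu_i:i<\omega\rangle$ is a strictly increasing sequence of regular cardinals cofinal in $\mu$ with $\sigma<\mu_0$. For each $\delta\in S$, $c^0_\delta$ is the increasing enumeration of a closed unbounded subset of $\delta$ of order type $\sigma$, and for every club $E\subseteq\lambda$ the set of $\delta\in S$ with $\mathrm{ran}(c^0_\delta)\subseteq E$ is stationary. For $\delta\in S$, $\epsilon<\sigma$, $m<\omega$, $I(\delta,\epsilon,m)$ is the half-open interval $(c^0_\delta(\omega\cdot\epsilon+m),c^0_\delta(\omega\cdot\epsilon+m+1)]$. $\bar C=\langle C_\delta:\delta\in S\rangle$ satisfies: $C_\delta$ is closed unbounded in $\delta$; $\mathrm{ran}(c^0_\delta)\subseteq C_\delta$; $|C_\delta\cap I(\delta,\epsilon,m)|\leq\mu_m^+$; every $\alpha\in\mathrm{nacc}(C_\delta)\cap I(\delta,\epsilon,m)$ has $\mathrm{cf}(\alpha)>\mu_m^+$; for every club $E\subseteq\lambda$ there are stationarily many $\delta\in S$ such that $E\cap\mathrm{nacc}(C_\delta)\cap I(\delta,\epsilon,m)\neq\emptyset$ for all $\epsilon<\sigma$, $m<\omega$. Here for $C$ club in $\delta$, $\mathrm{acc}(C)=\{\alpha<\delta:\alpha=\sup(\alpha\cap C)\}$, $\mathrm{nacc}(C)=C\setminus\mathrm{acc}(C)$.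 For $\delta\in S$, $I_\delta$ is the ideal on $C_\delta$ generated by the sets $\{\gamma\in C_\delta:\gamma\in\mathrm{acc}(C_\delta)\text{ or }\mathrm{cf}(\gamma)<\alpha\text{ or }\gamma<\beta\}$ for $\alpha<\mu$, $\beta<\delta$; $\mathrm{id}_p(\bar C,\bar I)$ is the ideal of all $A\subseteq\lambda$ for which there is a club $E\subseteq\lambda$ with $A\cap E\cap C_\delta\in I_\delta$ for all $\delta\in S\cap E$. $C_\delta[m]=\mathrm{ran}(c^0_\delta)\cup\bigcup\{C_\delta\cap I(\delta,\epsilon,i):\epsilon<\sigma, i\leq m\}$. A generalized $C$-sequence on $\lambda$ is a family $\langle e^m_\alpha:\alpha<\lambda,m<\omega\rangle$ with each $e^m_\alpha$ closed unbounded in $\alpha$ and $e^m_\alpha\subseteq e^{m+1}_\alpha$. Walks: for $\alpha<\beta<\lambda$ and $m<\omega$, $\beta^m_0(\alpha,\beta)=\beta$ and $\beta^m_{i+1}(\alpha,\beta)=\min(e^m_{\beta^m_i(\alpha,\beta)}\setminus\alpha)$ if $\beta^m_i(\alpha,\beta)>\alpha$, and $=\alpha$ otherwise; $\rho^m_2(\alpha,\beta)$ is the least $i$ with $\beta^m_i(\alpha,\beta)=\alpha$; the $m$-walk from $\beta$ to $\alpha$ is $\langle\beta^m_i(\alpha,\beta):i\leq\rho^m_2(\alpha,\beta)\rangle$. -}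

module Defs where

open import Axiom.ExcludedMiddle using (ExcludedMiddle)
open import Data.List.Base using (List)
open import Data.List.Relation.Unary.All using (All)
open import Data.List.Relation.Unary.Any using (Any)
open import Data.Nat.Base as ℕ using (ℕ; zero; suc)
open import Data.Product.Base using (Σ; ∃; _×_; _,_; proj₁)
open import Data.Sum.Base using (_⊎_)
open import Function.Bundles using (Injection)
open import Induction.WellFounded using (WellFounded; module All)
open import Level using (Level; _⊔_) renaming (suc to lsuc)
open import Relation.Binary.Bundles using (Setoid)
open import Relation.Binary.Construct.On as On using ()
import Relation.Binary.Construct.StrictToNonStrict as NonStrict
open import Relation.Binary.Core using (Rel)
open import Relation.Binary.PropositionalEquality using (_≡_; setoid)
open import Relation.Binary.Structures using (IsStrictTotalOrder)
open import Relation.Nullary using (¬_; Dec; yes; no)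
open import Relation.Unary using (Pred; _∈_; _⊆_; _∩_; _∪_; _∖_; U; _⟨⊎⟩_)

-- A nonempty well-ordered type, standing for an ordinal λ: its elements are
-- the ordinals below λ, each α being identified with {ξ | ξ < α}.
record WellOrder (ℓ : Level) : Set (lsuc ℓ) where
  infix 4 _<_
  field
    Ord                : Set ℓ
    _<_                : Rel Ord ℓ
    isStrictTotalOrder : IsStrictTotalOrder _≡_ _<_
    wellFounded        : WellFounded _<_
    𝟎                  : Ord
    𝟎-least            : ∀ α → ¬ α < 𝟎

  open NonStrict _≡_ _<_ public using (_≤_)

-- The members of A, compared by their underlying elements only, so that
-- proofs of membership do not affect cardinality.
⟦_⟧ : ∀ {a p} {X : Set a} → Pred X p → Setoid (a ⊔ p) a
⟦_⟧ {X = X} A = On.setoid {B = Σ X A} (setoid X) proj₁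

infix 4 _≲_

-- |A| ≤ |B|
_≲_ : ∀ {a b p q} {X : Set a} {Y : Set b} →
      Pred X p → Pred Y q → Set (a ⊔ b ⊔ p ⊔ q)
A ≲ B = Injection ⟦ A ⟧ ⟦ B ⟧

-- The ideal generated by the sets G i with i ∈ J.
IdealGeneratedBy : ∀ {a i j p} {X : Set a} {Ix : Set i} →
                   Pred Ix j → (Ix → Pred X p) → Pred (Pred X p) _
IdealGeneratedBy {Ix = Ix} J G A =
  ∃ λ (is : List Ix) → All J is × (∀ {x} → x ∈ A → Any (λ i → x ∈ G i) is)

-- The ambient theory is ZFC.  Excluded middle is assumed for all types, not
-- only for propositions, so it also yields choice functions.
module Ordinals (em : ∀ {a} → ExcludedMiddle a) {ℓ : Level} (L : WellOrder ℓ) where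

  open WellOrder L

  IsLeast : ∀ {p} → Pred Ord p → Pred Ord (ℓ ⊔ p)
  IsLeast P α = P α × (∀ {β} → P β → α ≤ β)

  from-dec : ∀ {p} {P : Pred Ord p} → Dec (∃ P) → Ord
  from-dec (yes (α , _)) = α
  from-dec (no _)        = 𝟎

  -- The least element of P, with the convention min ∅ = 0.
  min : ∀ {p} → Pred Ord p → Ord
  min P = from-dec (em {P = ∃ (IsLeast P)})

  ↓_ : Ord → Pred Ord ℓ
  (↓ α) ξ = ξ < α

  IsSup : ∀ {p} → Pred Ord p → Pred Ord (ℓ ⊔ p)
  IsSup A = IsLeast (λ β → ∀ {ξ} → ξ ∈ A → ξ ≤ β)

  IsLimit : Pred Ord ℓ
  IsLimit α = 𝟎 < α × (∀ {β} → β < α → ∃ λ γ → β < γ × γ < α)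

  ω : Ord
  ω = min IsLimit

  succ : Ord → Ord
  succ α = min (α <_)

  infixl 6 _+ⁿ_

  _+ⁿ_ : Ord → ℕ → Ord
  α +ⁿ zero  = α
  α +ⁿ suc n = succ (α +ⁿ n)

  infix 7 ω·_

  -- ω · ε is the least ordinal above all ω · ε′ + n with ε′ < ε and n < ω.
  ω·_ : Ord → Ord
  ω·_ = All.wfRec wellFounded ℓ (λ _ → Ord)
          λ ε ω·′ → min (λ γ → ∀ ε′ (ε′<ε : ε′ < ε) n → ω·′ ε′<ε +ⁿ n < γ)

  IsCardinal : Pred Ord ℓ
  IsCardinal κ = ∀ {α} → α < κ → ¬ (↓ κ ≲ ↓ α)

  infix 8 _⁺

  _⁺ : Ord → Ord
  κ ⁺ = min (λ ν → κ < ν × IsCardinal ν)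

  Cofinal : (Ord → Ord) → Ord → Ord → Set ℓ
  Cofinal f κ α = (∀ {i} → i < κ → f i < α)
                × (∀ {ξ} → ξ < α → ∃ λ i → i < κ × ξ ≤ f i)

  cf : Ord → Ord
  cf α = min (λ κ → ∃ λ f → Cofinal f κ α)

  IsRegular : Pred Ord ℓ
  IsRegular κ = IsCardinal κ × ω ≤ κ × cf κ ≡ κ

  IsSingular : Pred Ord ℓ
  IsSingular κ = IsCardinal κ × ω ≤ κ × cf κ < κ

  -- D is either ↓ δ (club in δ) or U (club in λ).  Unboundedness is meant with
  -- ≤, so that a successor γ + 1 has the club subset {γ}.
  record IsClubIn {d} (D : Pred Ord d) (C : Pred Ord ℓ) : Set (ℓ ⊔ d) where
    field
      subset    : C ⊆ D
      unbounded : ∀ {ξ} → ξ ∈ D → ∃ λ η → η ∈ C × ξ ≤ η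
      closed    : ∀ {α} → α ∈ D → 𝟎 < α → IsSup (C ∩ ↓ α) α → α ∈ C

  IsClub : Pred (Pred Ord ℓ) ℓ
  IsClub = IsClubIn U

  IsStationary : Pred (Pred Ord ℓ) (lsuc ℓ)
  IsStationary A = ∀ E → IsClub E → ∃ (A ∩ E)

  acc : Ord → Pred Ord ℓ → Pred Ord ℓ
  acc δ C α = α < δ × IsSup (C ∩ ↓ α) α

  nacc : Ord → Pred Ord ℓ → Pred Ord ℓ
  nacc δ C = C ∖ acc δ C

  record IsGeneralizedCSequence (e : ℕ → Ord → Pred Ord ℓ) : Set ℓ where
    field
      club     : ∀ m α → IsClubIn (↓ α) (e m α)
      monotone : ∀ m α → e m α ⊆ e (suc m) α

  step-dec : Pred Ord ℓ → (α β : Ord) → Dec (α < β) → Ord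
  step-dec eᵦ α β (yes _) = min (eᵦ ∖ ↓ α)
  step-dec eᵦ α β (no _)  = α

  -- walk e m α β i is β^m_i(α, β).
  walk : (ℕ → Ord → Pred Ord ℓ) → ℕ → Ord → Ord → ℕ → Ord
  walk e m α β zero    = β
  walk e m α β (suc i) = step-dec (e m βᵢ) α βᵢ em
    where βᵢ = walk e m α β i

  record Setting : Set (lsuc ℓ) where
    field
      μ            : Ord
      μ-singular   : IsSingular μ
      cf-μ         : cf μ ≡ ω

      -- λ = μ⁺
      λ-isCardinal : ∀ α → ¬ (U {A = Ord} ≲ ↓ α)
      λ-least      : ∀ ν → IsCardinal ν → ν ≤ μ

      σ            : Ord
      σ-regular    : IsRegular σ
      ω<σ          : ω < σ
      σ<μ          : σ < μ

      S            : Pred Ord ℓ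
      S-cf         : ∀ {δ} → δ ∈ S → cf δ ≡ σ
      S-stationary : IsStationary S

      μ⟨_⟩         : ℕ → Ord
      μᵢ-regular   : ∀ i → IsRegular μ⟨ i ⟩
      μᵢ-mono      : ∀ {i j} → i ℕ.< j → μ⟨ i ⟩ < μ⟨ j ⟩
      μᵢ<μ         : ∀ i → μ⟨ i ⟩ < μ
      μᵢ-cofinal   : ∀ {ξ} → ξ < μ → ∃ λ i → ξ ≤ μ⟨ i ⟩
      σ<μ₀         : σ < μ⟨ 0 ⟩

      -- Only the values c⁰ δ i with δ ∈ S and i < σ are meaningful.
      c⁰           : Ord → Ord → Ord

    ran-c⁰ : Ord → Pred Ord ℓ
    ran-c⁰ δ γ = ∃ λ i → i < σ × c⁰ δ i ≡ γ

    I : Ord → Ord → ℕ → Pred Ord ℓ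
    I δ ε m γ = c⁰ δ (ω· ε +ⁿ m) < γ × γ ≤ c⁰ δ (ω· ε +ⁿ suc m)

    field
      c⁰-increasing : ∀ {δ} → δ ∈ S → ∀ {i j} → i < j → j < σ → c⁰ δ i < c⁰ δ j
      c⁰-club       : ∀ {δ} → δ ∈ S → IsClubIn (↓ δ) (ran-c⁰ δ)
      c⁰-guessing   : ∀ E → IsClub E → IsStationary (λ δ → δ ∈ S × ran-c⁰ δ ⊆ E)

      -- Only C δ with δ ∈ S is meaningful.
      C             : Ord → Pred Ord ℓ
      C-club        : ∀ {δ} → δ ∈ S → IsClubIn (↓ δ) (C δ)
      ran-c⁰⊆C      : ∀ {δ} → δ ∈ S → ran-c⁰ δ ⊆ C δ
      C∩I-small     : ∀ {δ} → δ ∈ S → ∀ {ε} → ε < σ → ∀ m →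
                      C δ ∩ I δ ε m ≲ ↓ (μ⟨ m ⟩ ⁺)
      nacc-cf       : ∀ {δ} → δ ∈ S → ∀ {ε} → ε < σ → ∀ m {α} →
                      α ∈ nacc δ (C δ) ∩ I δ ε m → μ⟨ m ⟩ ⁺ < cf α
      C-guessing    : ∀ E → IsClub E →
                      IsStationary (λ δ → δ ∈ S ×
                        (∀ {ε} → ε < σ → ∀ m → ∃ (E ∩ nacc δ (C δ) ∩ I δ ε m)))

    C[_] : ℕ → Ord → Pred Ord ℓ
    C[ m ] δ = ran-c⁰ δ ∪
      (λ γ → ∃ λ ε → ∃ λ i → ε < σ × i ℕ.≤ m × γ ∈ C δ ∩ I δ ε i)

    ideal : Ord → Pred (Pred Ord ℓ) ℓ
    ideal δ = IdealGeneratedBy {Ix = Ord × Ord}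
      (λ (α , β) → α < μ × β < δ)
      (λ (α , β) → C δ ∩ (λ γ → γ ∈ acc δ (C δ) ⊎ cf γ < α ⊎ γ < β))

    idₚ : Pred (Pred Ord ℓ) (lsuc ℓ)
    idₚ A = ∃ λ E → IsClub E × (∀ {δ} → δ ∈ S ∩ E → A ∩ E ∩ C δ ∈ ideal δ)

{-# OPTIONS --safe #-}

-- Let δ ∈ S and let t β lie above δ.  For large m the m-walk from ξ ∈ t β to δ
-- no longer depends on m; let η be its last element before δ, so δ ∈ e m η.
-- Since cf δ > ω, there is a single θ < δ such that for all large m the m-walks
-- from ξ to points of (θ , δ) also reach η.  Let γ ∈ nacc (C δ) lie above θ with
-- cf γ large.  Then γ ∈ C[m] δ ⊆ e m η for some large m with μₘ⁺ < cf γ, while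
-- |e m η| ≤ cf η + μₘ⁺ keeps e m η ∩ γ bounded in γ, so the m-walk from ξ to any
-- point close enough below γ steps from η to γ.  If γ belongs to a suitable club,
-- such points include all of t α for some α < γ.

module Submission where

open import Defs
open import Axiom.ExcludedMiddle using (ExcludedMiddle)
open import Data.List.Base using (List; []; _∷_)
open import Data.List.Membership.Propositional using () renaming (_∈_ to _∈ᴸ_)
open import Data.List.Relation.Binary.Disjoint.Propositional using (Disjoint)
open import Data.List.Relation.Unary.All as All using (All; []; _∷_)
open import Data.List.Relation.Unary.Any using (here; there)
open import Data.Nat.Base as ℕ using (ℕ; zero; suc)
import Data.Nat.Properties as ℕₚ
open import Data.Product.Base using (Σ; ∃; _×_; _,_; proj₁; proj₂)
open import Data.Sum.Base using (_⊎_; inj₁; inj₂; [_,_]′)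
open import Data.Unit.Base using (⊤; tt)
open import Function.Base using (id; _∘_)
open import Function.Bundles using (Injection)
open import Induction.WellFounded using (Acc; module FixPoint) renaming (acc to accessible)
open import Level using (Level; _⊔_)
open import Relation.Binary.Definitions using (tri<; tri≈; tri>)
open import Relation.Binary.PropositionalEquality
  using (_≡_; _≢_; refl; sym; trans; cong; subst)
open import Relation.Binary.Structures using (IsStrictTotalOrder)
open import Relation.Nullary using (¬_; yes; no; contradiction)
open import Relation.Nullary.Decidable using (decidable-stable)
open import Relation.Unary using (Pred; _∈_; _⊆_; _∩_; _∖_; U; _⟨⊎⟩_)

module _ (em : ∀ {a} → ExcludedMiddle a) {ℓ : Level} (L : WellOrder ℓ) where

  open WellOrder L
  open Ordinals em L
  open IsStrictTotalOrder isStrictTotalOrder using (compare; irrefl)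
    renaming (trans to <-trans)

  -- Order, least elements and `min`.

  by-contradiction : ∀ {p} {P : Set p} → ¬ ¬ P → P
  by-contradiction = decidable-stable em

  <-irrefl : ∀ {α} → ¬ α < α
  <-irrefl = irrefl refl

  ≤-refl : ∀ {α} → α ≤ α
  ≤-refl = inj₂ refl

  <-≤-trans : ∀ {α β γ} → α < β → β ≤ γ → α < γ
  <-≤-trans α<β (inj₁ β<γ)  = <-trans α<β β<γ
  <-≤-trans α<β (inj₂ refl) = α<β

  ≤-<-trans : ∀ {α β γ} → α ≤ β → β < γ → α < γ
  ≤-<-trans (inj₁ α<β)  β<γ = <-trans α<β β<γ
  ≤-<-trans (inj₂ refl) β<γ = β<γ

  ≤-trans : ∀ {α β γ} → α ≤ β → β ≤ γ → α ≤ γ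
  ≤-trans α≤β (inj₁ β<γ)  = inj₁ (≤-<-trans α≤β β<γ)
  ≤-trans α≤β (inj₂ refl) = α≤β

  ≮⇒≥ : ∀ {α β} → ¬ α < β → β ≤ α
  ≮⇒≥ {α} {β} α≮β with compare α β
  ... | tri< α<β _ _ = contradiction α<β α≮β
  ... | tri≈ _ refl _ = ≤-refl
  ... | tri> _ _ β<α = inj₁ β<α

  ≤⇒≯ : ∀ {α β} → α ≤ β → ¬ β < α
  ≤⇒≯ α≤β β<α = <-irrefl (≤-<-trans α≤β β<α)

  ≰⇒> : ∀ {α β} → ¬ α ≤ β → β < α
  ≰⇒> α≰β = by-contradiction (α≰β ∘ ≮⇒≥)

  ≤-antisym : ∀ {α β} → α ≤ β → β ≤ α → α ≡ β
  ≤-antisym (inj₂ eq)  _   = eq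
  ≤-antisym (inj₁ α<β) β≤α = contradiction α<β (≤⇒≯ β≤α)

  𝟎≤ : ∀ {α} → 𝟎 ≤ α
  𝟎≤ = ≮⇒≥ (𝟎-least _)

  <⇒𝟎< : ∀ {α β} → α < β → 𝟎 < β
  <⇒𝟎< = ≤-<-trans 𝟎≤

  upper-bound : ∀ {d} {D : Pred Ord d} {α β} → α ∈ D → β ∈ D →
                ∃ λ γ → γ ∈ D × α ≤ γ × β ≤ γ
  upper-bound {α = α} {β} α∈D β∈D with compare α β
  ... | tri< α<β _ _  = β , β∈D , inj₁ α<β , ≤-refl
  ... | tri≈ _ refl _ = β , β∈D , ≤-refl , ≤-refl
  ... | tri> _ _ β<α  = α , α∈D , ≤-refl , inj₁ β<α

  least : ∀ {p} {P : Pred Ord p} → ∃ P → ∃ (IsLeast P)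
  least {P = P} (α , Pα) = go (wellFounded α) Pα
    where
    go : ∀ {α} → Acc _<_ α → P α → ∃ (IsLeast P)
    go {α} (accessible rs) Pα with em {P = ∃ λ β → β < α × P β}
    ... | yes (β , β<α , Pβ) = go (rs β<α) Pβ
    ... | no ¬∃ = α , Pα , λ Pβ → ≮⇒≥ λ β<α → ¬∃ (_ , β<α , Pβ)

  min-spec : ∀ {p} {P : Pred Ord p} → ∃ P → IsLeast P (min P)
  min-spec {P = P} ∃P with em {P = ∃ (IsLeast P)}
  ... | yes (_ , l) = l
  ... | no ¬l = contradiction (least ∃P) ¬l

  min-elim : ∀ {p t} {P : Pred Ord p} (T : Pred Ord t) → 𝟎 ∈ T → P ⊆ T → min P ∈ T
  min-elim {P = P} T T𝟎 P⊆T with em {P = ∃ (IsLeast P)}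
  ... | yes (_ , Pα , _) = P⊆T Pα
  ... | no _ = T𝟎

  min-unique : ∀ {p} {P : Pred Ord p} {α} → IsLeast P α → min P ≡ α
  min-unique (Pα , α-least) with min-spec (_ , Pα)
  ... | Pmin , min-least = ≤-antisym (min-least Pα) (α-least Pmin)

  min-cong : ∀ {p} {P Q : Pred Ord p} → P ⊆ Q → Q ⊆ P → min P ≡ min Q
  min-cong {P = P} {Q} P⊆Q Q⊆P with em {P = ∃ (IsLeast Q)}
  ... | yes (α , Qα , α-least) = min-unique (Q⊆P Qα , α-least ∘ P⊆Q)
  ... | no ¬Q = min-elim (_≡ 𝟎) refl λ Pα → contradiction (least (_ , P⊆Q Pα)) ¬Q

  -- Suprema, cofinality and bounds for small families.

  sup-approx : ∀ {p} {A : Pred Ord p} {α β} → IsSup A α → β < α →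
               ∃ λ ξ → ξ ∈ A × β < ξ
  sup-approx (_ , α-least) β<α = by-contradiction λ ¬∃ →
    ≤⇒≯ (α-least λ ξ∈A → ≮⇒≥ λ β<ξ → ¬∃ (_ , ξ∈A , β<ξ)) β<α

  ¬sup⇒bounded : ∀ {A : Pred Ord ℓ} {α} → ¬ IsSup (A ∩ ↓ α) α →
                 ∃ λ θ → θ < α × (∀ {ξ} → ξ ∈ A → ξ < α → ξ ≤ θ)
  ¬sup⇒bounded {A} {α} ¬sup = by-contradiction λ ¬∃ → ¬sup ((λ (_ , ξ<α) → inj₁ ξ<α) ,
    λ {β} ub → ≮⇒≥ λ β<α → ¬∃ (β , β<α , λ {ξ} ξ∈A ξ<α → ub (ξ∈A , ξ<α)))

  -- For `D` = `↓ α` this is `Cofinal f κ α`; `D` = `U` covers maps cofinal in λ, which is not an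
  -- element of `Ord`.
  CofinalIn : ∀ {d} → Pred Ord d → (Ord → Ord) → Ord → Set (ℓ ⊔ d)
  CofinalIn D f κ = (∀ {i} → i < κ → f i ∈ D)
                  × (∀ {ξ} → ξ ∈ D → ∃ λ i → i < κ × ξ ≤ f i)

  strictly-bounded : ∀ {d} {D : Pred Ord d} {κ} → (∀ f → ¬ CofinalIn D f κ) →
                     ∀ f → (∀ {i} → i < κ → f i ∈ D) →
                     ∃ λ ξ → ξ ∈ D × (∀ {i} → i < κ → f i < ξ)
  strictly-bounded ¬cof f f∈D = by-contradiction λ ¬∃ →
    ¬cof f (f∈D , λ ξ∈D → by-contradiction λ ¬i →
      ¬∃ (_ , ξ∈D , λ {i} i<κ → ≰⇒> λ ξ≤fi → ¬i (i , i<κ , ξ≤fi)))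

  opaque
    -- The keys turn a family over any type into a map on ordinals. An ordinal that is no key is
    -- sent to min ∅ = 0, whence `𝟎 ∈ D`.
    family-bounded : ∀ {d x} {D : Pred Ord d} {κ} → (∀ f → ¬ CofinalIn D f κ) → 𝟎 ∈ D →
                     {X : Set x} (key value : X → Ord) →
                     (∀ x → key x < κ) → (∀ x → value x ∈ D) →
                     (∀ {x y} → key x ≡ key y → value x ≡ value y) →
                     ∃ λ ξ → ξ ∈ D × (∀ x → value x < ξ)
    family-bounded {D = D} ¬cof 𝟎∈D {X} key value key<κ value∈D functional =
      let ξ , ξ∈D , bound = strictly-bounded ¬cof f (λ _ → f∈D _)
      in ξ , ξ∈D , λ x → subst (_< ξ) (f-key x) (bound (key<κ x))
      where
      f : Ord → Ord
      f i = min λ ξ → ∃ λ x → key x ≡ i × value x ≡ ξ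

      f∈D : ∀ i → f i ∈ D
      f∈D i = min-elim D 𝟎∈D λ { (x , _ , refl) → value∈D x }

      f-key : ∀ x → f (key x) ≡ value x
      f-key x = min-unique
        ((x , refl , refl) , λ { (_ , eq , refl) → inj₂ (functional (sym eq)) })

  id-cofinal : ∀ α → Cofinal id α α
  id-cofinal α = (λ i<α → i<α) , λ ξ<α → _ , ξ<α , ≤-refl

  cf-spec : ∀ α → IsLeast (λ κ → ∃ λ f → Cofinal f κ α) (cf α)
  cf-spec α = min-spec (α , id , id-cofinal α)

  <cf⇒¬cofinal : ∀ {κ α} → κ < cf α → ∀ f → ¬ CofinalIn (↓ α) f κ
  <cf⇒¬cofinal {α = α} κ<cf f cof = ≤⇒≯ (proj₂ (cf-spec α) (f , cof)) κ<cf

  <cf⇒𝟎< : ∀ {κ α} → κ < cf α → 𝟎 < α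
  <cf⇒𝟎< {κ} {α} κ<cf with 𝟎≤ {α}
  ... | inj₁ 𝟎<α  = 𝟎<α
  ... | inj₂ refl =
    contradiction (<-≤-trans κ<cf (proj₂ (cf-spec 𝟎) (id , id-cofinal 𝟎))) (𝟎-least _)

  cf-family-bounded : ∀ {x κ α} → κ < cf α → {X : Set x} (key value : X → Ord) →
                      (∀ x → key x < κ) → (∀ x → value x < α) →
                      (∀ {x y} → key x ≡ key y → value x ≡ value y) →
                      ∃ λ ξ → ξ < α × (∀ x → value x < ξ)
  cf-family-bounded κ<cf = family-bounded (<cf⇒¬cofinal κ<cf) (<cf⇒𝟎< κ<cf)

  <cf⇒limit : ∀ {κ α ξ} → 𝟎 < κ → κ < cf α → ξ < α → ∃ λ η → ξ < η × η < α
  <cf⇒limit {ξ = ξ} 𝟎<κ κ<cf ξ<α with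
    cf-family-bounded κ<cf {X = ⊤} (λ _ → 𝟎) (λ _ → ξ) (λ _ → 𝟎<κ) (λ _ → ξ<α) (λ _ → refl)
  ... | η , η<α , ξ<η = η , ξ<η tt , η<α

  -- By injectivity each `g i` comes from at most one member of `A`, so `i < κ` can serve as the key
  -- of that member.
  fibres-bounded : ∀ {y q} {Y : Set y} {A : Pred Ord ℓ} {B : Pred Y q} {κ α}
                   (A≲B : A ≲ B) (g : Ord → Y) → κ < cf α →
                   ∃ λ θ → θ < α × (∀ {ξ} (ξ∈A : ξ ∈ A) → ξ < α → ∀ {i} → i < κ →
                     proj₁ (Injection.to A≲B (ξ , ξ∈A)) ≡ g i → ξ < θ)
  fibres-bounded {A = A} {κ = κ} {α} A≲B g κ<cf
    with cf-family-bounded κ<cf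
           {X = ∃ λ i → i < κ × Σ (∃ A) λ x → proj₁ x < α × proj₁ (to x) ≡ g i}
           proj₁ (λ (_ , _ , (ξ , _) , _) → ξ)
           (λ (_ , i<κ , _) → i<κ) (λ (_ , _ , _ , ξ<α , _) → ξ<α)
           (λ { {_ , _ , _ , _ , p} {_ , _ , _ , _ , q} refl → injective (trans p (sym q)) })
    where open Injection A≲B using (to; injective)
  ... | θ , θ<α , bound =
    θ , θ<α , λ ξ∈A ξ<α i<κ eq → bound (_ , i<κ , (_ , ξ∈A) , ξ<α , eq)

  opaque
    -- Each of the two parts of `A`, split by the summand of the image, is bounded below `α`.
    ≲⊎⇒bounded : ∀ {A : Pred Ord ℓ} {κ ν α} → A ≲ (↓ κ ⟨⊎⟩ ↓ ν) → κ < cf α → ν < cf α →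
                 ∃ λ θ → θ < α × (∀ {ξ} → ξ ∈ A → ξ < α → ξ ≤ θ)
    ≲⊎⇒bounded {A} {κ} {ν} {α} A≲ κ<cf ν<cf
      with fibres-bounded A≲ inj₁ κ<cf | fibres-bounded A≲ inj₂ ν<cf
    ... | θ₁ , θ₁<α , bound₁ | θ₂ , θ₂<α , bound₂
      with upper-bound {D = ↓ α} θ₁<α θ₂<α
    ... | θ , θ<α , θ₁≤θ , θ₂≤θ = θ , θ<α , bound
      where
      bound : ∀ {ξ} → ξ ∈ A → ξ < α → ξ ≤ θ
      bound {ξ} ξ∈A ξ<α with Injection.to A≲ (ξ , ξ∈A) in eq
      ... | inj₁ i , i<κ = inj₁ (<-≤-trans (bound₁ ξ∈A ξ<α i<κ (cong proj₁ eq)) θ₁≤θ)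
      ... | inj₂ i , i<ν = inj₁ (<-≤-trans (bound₂ ξ∈A ξ<α i<ν (cong proj₁ eq)) θ₂≤θ)

  module _ (𝒮 : Setting) where

    open Setting 𝒮

    -- First facts on ω, successors and μ.

    𝟎<σ : 𝟎 < σ
    𝟎<σ = <⇒𝟎< ω<σ

    𝟎<μ : 𝟎 < μ
    𝟎<μ = <⇒𝟎< σ<μ

    ω<μ : ω < μ
    ω<μ = <-trans ω<σ σ<μ

    -- Were there no limit, ω would be min ∅ = 0 and so would cf μ, but no map of length 0 is
    -- cofinal in μ > 0.
    ω-limit : IsLimit ω
    ω-limit with em {P = ∃ IsLimit}
    ... | yes ∃limit = proj₁ (min-spec ∃limit)
    ... | no ¬limit = contradiction (subst (i <_) cf≡𝟎 i<cf) (𝟎-least i)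
      where
      cf≡𝟎 : cf μ ≡ 𝟎
      cf≡𝟎 = trans cf-μ
        (min-elim (_≡ 𝟎) refl λ lim → contradiction (_ , lim) ¬limit)
      f-cofinal = proj₂ (proj₁ (cf-spec μ))
      i = proj₁ (proj₂ f-cofinal 𝟎<μ)
      i<cf = proj₁ (proj₂ (proj₂ f-cofinal 𝟎<μ))

    -- If τ were the largest ordinal, {τ} would be a club.
    opaque
      no-max : ∀ τ → ∃ (τ <_)
      no-max τ = by-contradiction λ ¬∃ →
        let τ-max : ∀ {ξ} → ξ ≤ τ
            τ-max = ≮⇒≥ λ τ<ξ → ¬∃ (_ , τ<ξ)
            club = singleton-club τ-max
            δ , (δ∈S , ran⊆) , δ≡τ = c⁰-guessing (_≡ τ) club (_≡ τ) club
            𝟎∈ran = 𝟎 , 𝟎<σ , refl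
            c𝟎<δ = IsClubIn.subset (c⁰-club δ∈S) 𝟎∈ran
        in <-irrefl (subst (_< δ) (trans (ran⊆ 𝟎∈ran) (sym δ≡τ)) c𝟎<δ)
        where
        singleton-club : (∀ {ξ} → ξ ≤ τ) → IsClub (_≡ τ)
        singleton-club τ-max = record
          { subset = λ _ → _
          ; unbounded = λ _ → τ , refl , τ-max
          ; closed = λ _ 𝟎<α sup → let _ , (ξ≡τ , ξ<α) , _ = sup-approx sup 𝟎<α
                                   in contradiction (subst (_< _) ξ≡τ ξ<α) (≤⇒≯ τ-max)
          }

    succ-spec : ∀ α → IsLeast (α <_) (succ α)
    succ-spec α = min-spec (no-max α)

    <succ : ∀ {α} → α < succ α
    <succ = proj₁ (succ-spec _)

    <⇒succ≤ : ∀ {α β} → α < β → succ α ≤ β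
    <⇒succ≤ = proj₂ (succ-spec _)

    limit⇒succ< : ∀ {α β} → IsLimit α → β < α → succ β < α
    limit⇒succ< (_ , dense) β<α with dense β<α
    ... | _ , β<γ , γ<α = ≤-<-trans (<⇒succ≤ β<γ) γ<α

    +ⁿ<limit : ∀ {α β} → (∀ {γ} → γ < α → succ γ < α) → β < α → ∀ n → β +ⁿ n < α
    +ⁿ<limit lim β<α zero    = β<α
    +ⁿ<limit lim β<α (suc n) = lim (+ⁿ<limit lim β<α n)

    +ⁿ-mono-< : ∀ {α m n} → m ℕ.< n → α +ⁿ m < α +ⁿ n
    +ⁿ-mono-< {n = suc n} (ℕ.s≤s m≤n) with ℕₚ.m≤n⇒m<n∨m≡n m≤n
    ... | inj₁ m<n  = <-trans (+ⁿ-mono-< m<n) <succ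
    ... | inj₂ refl = <succ

    +ⁿ-injective : ∀ {α} m n → α +ⁿ m ≡ α +ⁿ n → m ≡ n
    +ⁿ-injective {α} m n eq with ℕₚ.<-cmp m n
    ... | tri< m<n _ _ = contradiction (subst (_< α +ⁿ n) eq (+ⁿ-mono-< m<n)) <-irrefl
    ... | tri≈ _ m≡n _ = m≡n
    ... | tri> _ _ n<m = contradiction (subst (α +ⁿ n <_) eq (+ⁿ-mono-< n<m)) <-irrefl

    opaque
      sequence-bounded : ∀ {d} {D : Pred Ord d} → (∀ f → ¬ CofinalIn D f ω) → 𝟎 ∈ D →
                         (s : ℕ → Ord) → (∀ n → s n ∈ D) →
                         ∃ λ ξ → ξ ∈ D × (∀ n → s n < ξ)
      sequence-bounded ¬cof 𝟎∈D s s∈D =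
        family-bounded ¬cof 𝟎∈D (𝟎 +ⁿ_) s
          (+ⁿ<limit (limit⇒succ< ω-limit) (proj₁ ω-limit)) s∈D
          λ {m} {n} eq → cong s (+ⁿ-injective m n eq)

    opaque
      μ-dense : ∀ {ξ} → ξ < μ → ∃ λ i → ξ < μ⟨ i ⟩
      μ-dense ξ<μ with μᵢ-cofinal ξ<μ
      ... | i , ξ≤μᵢ = suc i , ≤-<-trans ξ≤μᵢ (μᵢ-mono (ℕₚ.n<1+n i))

    opaque
      succ<μ : ∀ {ξ} → ξ < μ → succ ξ < μ
      succ<μ ξ<μ with μ-dense ξ<μ
      ... | i , ξ<μᵢ = ≤-<-trans (<⇒succ≤ ξ<μᵢ) (μᵢ<μ i)

    -- Cardinals below μ, and the regularity of λ.

    μ⁺-spec : ∀ i → IsLeast (λ ν → μ⟨ i ⟩ < ν × IsCardinal ν) (μ⟨ i ⟩ ⁺)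
    μ⁺-spec i = min-spec (μ , μᵢ<μ i , λ {_} → proj₁ μ-singular)

    μᵢ<μᵢ⁺ : ∀ i → μ⟨ i ⟩ < μ⟨ i ⟩ ⁺
    μᵢ<μᵢ⁺ i = proj₁ (proj₁ (μ⁺-spec i))

    μᵢ⁺<μ : ∀ i → μ⟨ i ⟩ ⁺ < μ
    μᵢ⁺<μ i = ≤-<-trans
      (proj₂ (μ⁺-spec i) (μᵢ-mono (ℕₚ.n<1+n i) , λ {_} → proj₁ (μᵢ-regular (suc i))))
      (μᵢ<μ (suc i))

    -- An injection of `↓ κ` into a smaller `↓ α` would key the values of `f` by ordinals below `α`;
    -- by minimality of `κ` they would then be strictly bounded in `D`.
    least-cofinal-isCardinal : ∀ {d} {D : Pred Ord d} {κ} → 𝟎 ∈ D →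
      IsLeast (λ κ → ∃ λ f → CofinalIn D f κ) κ → IsCardinal κ
    least-cofinal-isCardinal {D = D} {κ} 𝟎∈D ((f , f∈D , f-cof) , κ-least) {α} α<κ ↓κ≲↓α
      with family-bounded {D = D} (λ g g-cof → ≤⇒≯ (κ-least (g , g-cof)) α<κ) 𝟎∈D
             (proj₁ ∘ to) (f ∘ proj₁) (proj₂ ∘ to) (f∈D ∘ proj₂) (cong f ∘ injective)
      where open Injection ↓κ≲↓α using (to; injective)
    ... | ξ , ξ∈D , bound with f-cof ξ∈D
    ... | i , i<κ , ξ≤fi = ≤⇒≯ ξ≤fi (bound (i , i<κ))

    -- A least cofinal map of length μ would, since cf μ = ω, give one of length ω.
    least-cofinal<μ : ∀ {d} {D : Pred Ord d} {κ} → 𝟎 ∈ D →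
      IsLeast (λ κ → ∃ λ f → CofinalIn D f κ) κ → κ < μ
    least-cofinal<μ {D = D} 𝟎∈D l with λ-least _ (least-cofinal-isCardinal {D = D} 𝟎∈D l)
    ... | inj₁ κ<μ  = κ<μ
    least-cofinal<μ {D = D} 𝟎∈D ((f , f∈D , f-cof) , μ-least) | inj₂ refl =
      contradiction ω<μ (≤⇒≯ (μ-least (h , h-cofinal)))
      where
      g = proj₁ (proj₁ (cf-spec μ))

      g-cofinal : Cofinal g ω μ
      g-cofinal = subst (λ κ → Cofinal g κ μ) cf-μ (proj₂ (proj₁ (cf-spec μ)))

      Bound : Ord → Pred Ord _
      Bound j ξ = ξ ∈ D × (∀ {i} → i < g j → f i < ξ)

      h : Ord → Ord
      h j = min (Bound j)

      h-bound : ∀ {j} → j < ω → h j ∈ Bound j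
      h-bound {j} j<ω = proj₁ (min-spec (strictly-bounded
        (λ f′ f′-cof → ≤⇒≯ (μ-least (f′ , f′-cof)) gj<μ) f λ i<gj → f∈D (<-trans i<gj gj<μ)))
        where gj<μ = proj₁ g-cofinal j<ω

      h-cofinal : CofinalIn D h ω
      h-cofinal = (λ j<ω → proj₁ (h-bound j<ω)) , λ ξ∈D →
        let i , i<μ , ξ≤fi = f-cof ξ∈D
            -- `h j` exceeds only the `f i` with `i < g j`, so `g` is made to reach the successor of
            -- `i`.
            j , j<ω , i+1≤gj = proj₂ g-cofinal (succ<μ i<μ)
        in j , j<ω , ≤-trans ξ≤fi (inj₁ (proj₂ (h-bound j<ω) (<-≤-trans <succ i+1≤gj)))

    opaque
      cf<μ : ∀ {α} → 𝟎 < α → cf α < μ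
      cf<μ {α} 𝟎<α = least-cofinal<μ {D = ↓ α} 𝟎<α (cf-spec α)

    -- The partial suprema of a shortest cofinal map f : κ → λ form a club whose
    -- elements have cofinality below κ, contradicting the guessing by C̄.
    least-cofinal≮μ : ∀ {κ f} → CofinalIn U f κ → (∀ {i} → i < κ → ∀ f → ¬ CofinalIn U f i) →
                      ∀ m → ¬ κ < μ⟨ m ⟩
    least-cofinal≮μ {κ} {f} (_ , f-cof) κ-least m κ<μₘ =
      let _ , (δ∈S , hits) , _ = C-guessing E E-club E E-club
      in ¬hit δ∈S (hits 𝟎<σ m)
      where
      Bound : Ord → Pred Ord ℓ
      Bound i γ = ∀ {j} → j < i → f j < γ

      h : Ord → Ord
      h i = min (Bound i)

      h-least : ∀ {i} → i < κ → IsLeast (Bound i) (h i)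
      h-least i<κ =
        let γ , _ , bound = strictly-bounded {D = U} (κ-least i<κ) f (λ _ → tt)
        in min-spec (γ , λ {_} → bound)

      h-mono : ∀ {i j} → j < κ → i ≤ j → h i ≤ h j
      h-mono j<κ i≤j = proj₂ (h-least (≤-<-trans i≤j j<κ))
        λ k<i → proj₁ (h-least j<κ) (<-≤-trans k<i i≤j)

      -- `h i` is known to exceed `f j` only for `j < i`. So a second index with a larger value of
      -- `f` is taken, and `h` is evaluated at the larger index.
      h-unbounded : ∀ ξ → ∃ λ i → i < κ × ξ ≤ h i
      h-unbounded ξ with f-cof {ξ} tt
      ... | j , j<κ , ξ≤fj with no-max (f j)
      ... | ξ′ , fj<ξ′ with f-cof {ξ′} tt
      ... | i , i<κ , ξ′≤fi with compare i j
      ... | tri< i<j _ _ = j , j<κ , ≤-trans ξ≤fj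
              (inj₁ (<-trans fj<ξ′ (≤-<-trans ξ′≤fi (proj₁ (h-least j<κ) i<j))))
      ... | tri≈ _ refl _ = contradiction (<-≤-trans fj<ξ′ ξ′≤fi) <-irrefl
      ... | tri> _ _ j<i = i , i<κ , ≤-trans ξ≤fj (inj₁ (proj₁ (h-least i<κ) j<i))

      E : Pred Ord ℓ
      E γ = ∃ λ i → i < κ × h i ≡ γ

      -- Let `i` be least with `α ≤ h i`. For `j < i` some `h k < α` lies above `h j`; then `j < k`,
      -- so `f j < h k < α`. Hence `h i ≤ α`.
      E-closed : ∀ {α} → IsSup (E ∩ ↓ α) α → α ∈ E
      E-closed {α} sup with least (h-unbounded α)
      ... | i , (i<κ , α≤hi) , i-least = i , i<κ , ≤-antisym (proj₂ (h-least i<κ) f<α) α≤hi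
        where
        f<α : Bound i α
        f<α {j} j<i with sup-approx sup (≰⇒> λ α≤hj → ≤⇒≯ (i-least (<-trans j<i i<κ , α≤hj)) j<i)
        ... | _ , ((k , k<κ , refl) , hk<α) , hj<hk =
          <-trans (proj₁ (h-least k<κ) (≰⇒> λ k≤j → ≤⇒≯ (h-mono (<-trans j<i i<κ) k≤j) hj<hk)) hk<α

      E-club : IsClub E
      E-club = record
        { subset = λ _ → tt
        ; unbounded = λ {ξ} _ → let i , i<κ , ξ≤hi = h-unbounded ξ
                                in h i , (i , i<κ , refl) , ξ≤hi
        ; closed = λ _ _ → E-closed
        }

      cf-h : ∀ {i} → i < κ → cf (h i) < κ
      cf-h {i} i<κ = ≤-<-trans (proj₂ (cf-spec (h i)) (f , proj₁ (h-least i<κ) , cofinal)) i<κ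
        where
        cofinal : ∀ {ξ} → ξ < h i → ∃ λ j → j < i × ξ ≤ f j
        cofinal ξ<hi = by-contradiction λ ¬∃ → ≤⇒≯
          (proj₂ (h-least i<κ) λ {j} j<i → ≰⇒> λ ξ≤fj → ¬∃ (j , j<i , ξ≤fj)) ξ<hi

      ¬hit : ∀ {δ} → δ ∈ S → ¬ ∃ (E ∩ nacc δ (C δ) ∩ I δ 𝟎 m)
      ¬hit δ∈S (_ , (i , i<κ , refl) , hi∈nacc∩I) = <-irrefl
        (<-trans (cf-h i<κ) (<-trans κ<μₘ
          (<-trans (μᵢ<μᵢ⁺ m) (nacc-cf δ∈S 𝟎<σ m hi∈nacc∩I))))

    opaque
      -- Since `κ` ranges over the ordinals below λ, this is regularity of λ. A shortest cofinal map
      -- would have length below some `μ⟨ m ⟩`.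
      λ-regular : ∀ {κ} f → ¬ CofinalIn U f κ
      λ-regular {κ₀} f₀ cof₀ with least {P = λ κ → ∃ λ f → CofinalIn U f κ} (κ₀ , f₀ , cof₀)
      ... | κ , l@((_ , cof) , κ-least) with μ-dense (least-cofinal<μ {D = U} tt l)
      ... | m , κ<μₘ = least-cofinal≮μ cof (λ i<κ f f-cof → ≤⇒≯ (κ-least (f , f-cof)) i<κ) m κ<μₘ

    -- Clubs of closure points.

    IsClosedUnder : (Ord → Ord) → Pred Ord ℓ
    IsClosedUnder g γ = ∀ {ζ} → ζ < γ → g ζ < γ

    opaque
      -- For unboundedness, bounds for `g` are iterated ω times. An ordinal below the least strict
      -- bound of the iterates is at most some iterate, and the next iterate bounds its image.
      closure-club : ∀ g → IsClub (IsClosedUnder g)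
      closure-club g = record
        { subset = λ _ → tt
        ; unbounded = λ {ξ} _ → unbounded ξ
        ; closed = λ _ _ sup ζ<α →
            let _ , (closed , γ<α) , ζ<γ = sup-approx sup ζ<α
            in <-trans (closed ζ<γ) γ<α
        }
        where
        next : ∀ ξ → ∃ λ ξ′ → ξ < ξ′ × (∀ {ζ} → ζ ≤ ξ → g ζ < ξ′)
        next ξ =
          let η , _ , bound = strictly-bounded {D = U} {κ = succ ξ} λ-regular g (λ _ → tt)
              ξ′ , _ , η≤ξ′ , ξ+1≤ξ′ = upper-bound {D = U} {η} {succ ξ} tt tt
          in ξ′ , <-≤-trans <succ ξ+1≤ξ′ , λ ζ≤ξ → <-≤-trans (bound (≤-<-trans ζ≤ξ <succ)) η≤ξ′

        iterate : Ord → ℕ → Ord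
        iterate ξ zero    = ξ
        iterate ξ (suc n) = proj₁ (next (iterate ξ n))

        unbounded : ∀ ξ → ∃ λ γ → γ ∈ IsClosedUnder g × ξ ≤ γ
        unbounded ξ with sequence-bounded {D = U} λ-regular tt (iterate ξ) (λ _ → tt)
        ... | γ₀ , _ , bound₀ with least {P = λ γ → ∀ n → iterate ξ n < γ} (γ₀ , bound₀)
        ... | γ , bound , γ-least = γ , closed , inj₁ (bound 0)
          where
          closed : γ ∈ IsClosedUnder g
          closed {ζ} ζ<γ = by-contradiction λ gζ≮γ → ≤⇒≯
            (γ-least λ n → ≰⇒> λ ζ≤ → gζ≮γ
              (<-trans (proj₂ (proj₂ (next (iterate ξ n))) ζ≤) (bound (suc n)))) ζ<γ

    -- Ordinals in the form ω · ε + n.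

    ω·-unfold : ∀ ε → ω· ε ≡ min (λ γ → ∀ ε′ (ε′<ε : ε′ < ε) n → ω· ε′ +ⁿ n < γ)
    ω·-unfold ε = FixPoint.unfold-wfRec wellFounded (λ _ → Ord) step step-cong {ε}
      where
      Above : ∀ ε → (∀ {ε′} → ε′ < ε → Ord) → Pred Ord ℓ
      Above ε ω·′ γ = ∀ ε′ (ε′<ε : ε′ < ε) n → ω·′ ε′<ε +ⁿ n < γ

      step : ∀ ε → (∀ {ε′} → ε′ < ε → Ord) → Ord
      step ε ω·′ = min (Above ε ω·′)

      step-cong : ∀ ε {f g : ∀ {ε′} → ε′ < ε → Ord} →
                  (∀ {ε′} (ε′<ε : ε′ < ε) → f ε′<ε ≡ g ε′<ε) → step ε f ≡ step ε g
      step-cong ε eq = min-cong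
        (λ above ε′ ε′<ε n → subst (λ ζ → ζ +ⁿ n < _) (eq ε′<ε) (above ε′ ε′<ε n))
        (λ above ε′ ε′<ε n → subst (λ ζ → ζ +ⁿ n < _) (sym (eq ε′<ε)) (above ε′ ε′<ε n))

    -- The bound `α` makes the defining set of `ω· ε` nonempty, so `min` does not fall back to 0.
    ω·-least : ∀ {α ε} → (∀ {ε′} → ε′ < ε → ∀ n → ω· ε′ +ⁿ n < α) →
               IsLeast (λ γ → ∀ ε′ (ε′<ε : ε′ < ε) n → ω· ε′ +ⁿ n < γ) (ω· ε)
    ω·-least {α} {ε} bound = subst (IsLeast _) (sym (ω·-unfold ε))
      (min-spec (α , λ _ → bound))

    -- The least `ε` with `j ≤ ω· ε` gives equality. If there were none up to `j`, then `ω·` would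
    -- be strictly increasing up to `j`, so that `j ≤ ω· j` after all. The case `j` = 0 is included.
    limit-decompose : ∀ {j} → (∀ {i} → i < j → succ i < j) → ∃ λ ε → ε ≤ j × j ≡ ω· ε
    limit-decompose {j} lim with em {P = ∃ λ ε → ε ≤ j × j ≤ ω· ε}
    ... | yes ∃ε with least ∃ε
    ... | ε , (ε≤j , j≤ω·ε) , ε-least =
      ε , ε≤j , ≤-antisym j≤ω·ε (proj₂ (ω·-least below) λ _ → below)
      where
      below : ∀ {ε′} → ε′ < ε → ∀ n → ω· ε′ +ⁿ n < j
      below ε′<ε = +ⁿ<limit lim (≰⇒> λ j≤ω·ε′ →
        ≤⇒≯ (ε-least (inj₁ (<-≤-trans ε′<ε ε≤j) , j≤ω·ε′)) ε′<ε)
    limit-decompose {j} lim | no ¬∃ε =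
      contradiction (below ≤-refl) (≤⇒≯ (inflationary (wellFounded j) ≤-refl))
      where
      below : ∀ {ε} → ε ≤ j → ω· ε < j
      below ε≤j = ≰⇒> λ j≤ω·ε → ¬∃ε (_ , ε≤j , j≤ω·ε)

      increasing : ∀ {ε ε′} → ε ≤ j → ε′ < ε → ω· ε′ < ω· ε
      increasing ε≤j ε′<ε = proj₁
        (ω·-least λ ε″<ε → +ⁿ<limit lim (below (inj₁ (<-≤-trans ε″<ε ε≤j)))) _ ε′<ε 0

      inflationary : ∀ {ε} → Acc _<_ ε → ε ≤ j → ε ≤ ω· ε
      inflationary (accessible rs) ε≤j = ≮⇒≥ λ ω·ε<ε →
        ≤⇒≯ (inflationary (rs ω·ε<ε) (inj₁ (<-≤-trans ω·ε<ε ε≤j))) (increasing ε≤j ω·ε<ε)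

    ¬succ⇒limit : ∀ {j} → ¬ (∃ λ i → j ≡ succ i) → ∀ {i} → i < j → succ i < j
    ¬succ⇒limit j≢succ i<j = [ id , (λ eq → contradiction (_ , sym eq) j≢succ) ]′ (<⇒succ≤ i<j)

    -- Successors are removed until `limit-decompose` applies. The clause `ε ≤ j` later puts `ε`
    -- below σ.
    ω·+ⁿ-decompose : ∀ j → ∃ λ ε → ∃ λ n → ε ≤ j × j ≡ ω· ε +ⁿ n
    ω·+ⁿ-decompose j = go (wellFounded j)
      where
      go : ∀ {j} → Acc _<_ j → ∃ λ ε → ∃ λ n → ε ≤ j × j ≡ ω· ε +ⁿ n
      go {j} (accessible rs) with em {P = ∃ λ i → j ≡ succ i}
      ... | yes (i , refl) with go (rs <succ)
      ...   | ε , n , ε≤i , i≡ = ε , suc n , inj₁ (≤-<-trans ε≤i <succ) , cong succ i≡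
      go {j} (accessible rs) | no j≢succ
        with limit-decompose (¬succ⇒limit j≢succ)
      ... | ε , ε≤j , j≡ω·ε = ε , 0 , ε≤j , j≡ω·ε

    -- Non-accumulation points of `C δ` lie in the intervals `I δ ε n`.

    module _ {δ : Ord} (δ∈S : δ ∈ S) where

      private module C⁰ = IsClubIn (c⁰-club δ∈S)

      opaque
        ω<cf-δ : ω < cf δ
        ω<cf-δ = subst (ω <_) (sym (S-cf δ∈S)) ω<σ

      succ<δ : ∀ {ξ} → ξ < δ → succ ξ < δ
      succ<δ ξ<δ with <cf⇒limit (proj₁ ω-limit) ω<cf-δ ξ<δ
      ... | _ , ξ<η , η<δ = ≤-<-trans (<⇒succ≤ ξ<η) η<δ

      c⁰∈ran : ∀ {i} → i < σ → c⁰ δ i ∈ ran-c⁰ δ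
      c⁰∈ran i<σ = _ , i<σ , refl

      c⁰-reflects-< : ∀ {i j} → i < σ → c⁰ δ i < c⁰ δ j → i < j
      c⁰-reflects-< i<σ ci<cj = ≰⇒>
        [ (λ j<i → <-irrefl (<-trans ci<cj (c⁰-increasing δ∈S j<i i<σ)))
        , (λ { refl → <-irrefl ci<cj }) ]′

      -- Otherwise the supremum `θ` of the `c⁰ δ i` with `i < j` is below `γ` and, the range being
      -- closed, equals some `c⁰ δ k`. Then `k < j`, although `θ` exceeds all such values.
      c⁰-limit∈acc : ∀ {γ j} → γ < δ → j < σ → (∀ {i} → i < j → succ i < j) →
                     (∀ {i} → i < j → c⁰ δ i < γ) → γ ≤ c⁰ δ j → c⁰ δ 𝟎 < γ →
                     γ ∈ acc δ (C δ)
      c⁰-limit∈acc {γ} {j} γ<δ j<σ lim c⁰<γ γ≤cj c𝟎<γ = γ<δ , by-contradiction ¬¬sup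
        where
        ¬¬sup : ¬ ¬ IsSup (C δ ∩ ↓ γ) γ
        ¬¬sup ¬sup with ¬sup⇒bounded ¬sup
        ... | θ₀ , θ₀<γ , bound₀
          with least {P = λ θ → ∀ {i} → i < j → c⁰ δ i ≤ θ}
                 (θ₀ , λ i<j → bound₀ (ran-c⁰⊆C δ∈S (c⁰∈ran (<-trans i<j j<σ))) (c⁰<γ i<j))
        ... | θ , θ-bound , θ-least =
          θ∉ran (C⁰.closed (<-trans θ<γ γ<δ) (<⇒𝟎< (c⁰<θ 𝟎<j)) θ-sup)
          where
          -- The hypothesis `c⁰ δ 𝟎 < γ` excludes `j` = 0, which `lim` allows.
          𝟎<j : 𝟎 < j
          𝟎<j = c⁰-reflects-< 𝟎<σ (<-≤-trans c𝟎<γ γ≤cj)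

          θ<γ : θ < γ
          θ<γ = ≤-<-trans (θ-least λ i<j →
            bound₀ (ran-c⁰⊆C δ∈S (c⁰∈ran (<-trans i<j j<σ))) (c⁰<γ i<j)) θ₀<γ

          c⁰<θ : ∀ {i} → i < j → c⁰ δ i < θ
          c⁰<θ i<j = <-≤-trans (c⁰-increasing δ∈S <succ (<-trans (lim i<j) j<σ)) (θ-bound (lim i<j))

          θ-sup : IsSup (ran-c⁰ δ ∩ ↓ θ) θ
          θ-sup = (λ (_ , ξ<θ) → inj₁ ξ<θ) ,
            λ ub → θ-least λ i<j → ub (c⁰∈ran (<-trans i<j j<σ) , c⁰<θ i<j)

          θ∉ran : ¬ θ ∈ ran-c⁰ δ
          θ∉ran (k , k<σ , refl) =
            <-irrefl (c⁰<θ (c⁰-reflects-< k<σ (<-≤-trans θ<γ γ≤cj)))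

      opaque
        -- Above `c⁰ δ 𝟎` the intervals miss only values of `c⁰ δ` at limits, which are accumulation
        -- points. So the least `j` with `γ ≤ c⁰ δ j` is a successor.
        nacc⇒∈I : ∀ {γ} → γ ∈ nacc δ (C δ) → c⁰ δ 𝟎 < γ → ∃ λ ε → ∃ λ n → ε < σ × γ ∈ I δ ε n
        nacc⇒∈I {γ} (γ∈C , γ∉acc) c𝟎<γ with IsClubIn.subset (C-club δ∈S) γ∈C
        ... | γ<δ with C⁰.unbounded γ<δ
        ... | _ , (j₀ , j₀<σ , refl) , γ≤cj₀
          with least {P = λ j → j < σ × γ ≤ c⁰ δ j} (j₀ , j₀<σ , γ≤cj₀)
        ... | j , (j<σ , γ≤cj) , j-least with em {P = ∃ λ i → j ≡ succ i}
        ...   | no j≢succ = contradiction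
          (c⁰-limit∈acc γ<δ j<σ (¬succ⇒limit j≢succ)
            (λ i<j → ≰⇒> λ γ≤ci → ≤⇒≯ (j-least (<-trans i<j j<σ , γ≤ci)) i<j) γ≤cj c𝟎<γ)
          γ∉acc
        ...   | yes (i , refl) with ω·+ⁿ-decompose i
        ...     | ε , n , ε≤i , refl = ε , n , ≤-<-trans ε≤i i<σ , ci<γ , γ≤cj
          where
          i<σ : i < σ
          i<σ = <-trans <succ j<σ

          ci<γ : c⁰ δ i < γ
          ci<γ = ≰⇒> λ γ≤ci → ≤⇒≯ (j-least (i<σ , γ≤ci)) <succ

    -- Walks to `δ` and through points below it.

    module _ {e : ℕ → Ord → Pred Ord ℓ} (e-seq : IsGeneralizedCSequence e) where

      open IsGeneralizedCSequence e-seq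

      monotone-≤ : ∀ {m n α} → m ℕ.≤′ n → e m α ⊆ e n α
      monotone-≤ ℕ.≤′-refl       = id
      monotone-≤ (ℕ.≤′-step m≤n) = monotone _ _ ∘ monotone-≤ m≤n

      walk-suc : ∀ {m ζ ξ k η τ} → walk e m ζ ξ k ≡ η → ζ < η →
                 IsLeast (e m η ∖ ↓ ζ) τ → walk e m ζ ξ (suc k) ≡ τ
      walk-suc {ζ = ζ} {η = η} refl ζ<η τ-least with em {P = ζ < η}
      ... | yes _  = min-unique τ-least
      ... | no ζ≮η = contradiction ζ<η ζ≮η

      -- `walk` recurses on its last step, while `stable-walk` splits off the first.
      walk-shift : ∀ {m ζ ξ} k → walk e m ζ (walk e m ζ ξ 1) k ≡ walk e m ζ ξ (suc k)
      walk-shift zero = refl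
      walk-shift {m} {ζ} (suc k) = cong (λ η → step-dec (e m η) ζ η em) (walk-shift k)

      -- At `η` the walk from `ξ` to `δ` is about to step to `δ`. The choice of `η`, `k` and `γ`
      -- precedes `m`, so it serves all large `m` at once.
      StableWalk : Ord → Ord → Set ℓ
      StableWalk δ ξ = ∃ λ m₀ → ∃ λ η → ∃ λ k → ∃ λ γ → γ < δ ×
        (∀ {m} → m₀ ℕ.≤ m → δ ∈ e m η × (∀ {ζ} → γ < ζ → ζ < δ → walk e m ζ ξ k ≡ η))

      module _ {δ : Ord} (ω<cf-δ : ω < cf δ) where

        𝟎<δ : 𝟎 < δ
        𝟎<δ = <cf⇒𝟎< ω<cf-δ

        Next : ℕ → Ord → Pred Ord ℓ
        Next m ξ = IsLeast (e m ξ ∖ ↓ δ)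

        -- As e m ξ increases with m, the least element of e m ξ ∖ δ decreases,
        -- so it is eventually constant.
        eventual-next : ∀ {ξ} → δ < ξ → ∃ λ τ → ∃ λ m₀ → ∀ {m} → m₀ ℕ.≤ m → τ ∈ Next m ξ
        eventual-next {ξ} δ<ξ
          with least {P = λ τ → ∃ λ m → τ ∈ Next m ξ} (_ , 0 , proj₂ (next 0))
          where
          next : ∀ m → ∃ (Next m ξ)
          next m with IsClubIn.unbounded (club m ξ) δ<ξ
          ... | η , η∈e , δ≤η = least (η , η∈e , ≤⇒≯ δ≤η)
        ... | τ , (m₀ , (τ∈e , τ≮δ) , _) , τ-least = τ , m₀ , λ m₀≤m →
          (monotone-≤ (ℕₚ.≤⇒≤′ m₀≤m) τ∈e , τ≮δ) ,
          λ x∈ → let υ , υ-next = least (_ , x∈)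
                 in ≤-trans (τ-least (_ , υ-next)) (proj₂ υ-next x∈)

        -- δ has uncountable cofinality, so a single bound works for all m.
        skip-below : ∀ {ξ τ m₀} → δ < ξ → δ < τ → (∀ {m} → m₀ ℕ.≤ m → τ ∈ Next m ξ) →
                     ∃ λ γ → γ < δ × (∀ {m ζ} → m₀ ℕ.≤ m → γ < ζ → ζ < δ →
                       IsLeast (e m ξ ∖ ↓ ζ) τ)
        skip-below {ξ} {τ} {m₀} δ<ξ δ<τ τ-next =
          let γ , γ<δ , θ<γ = sequence-bounded (<cf⇒¬cofinal ω<cf-δ) 𝟎<δ
                (proj₁ ∘ gap) (proj₁ ∘ proj₂ ∘ gap)
          in γ , γ<δ , λ {m} {ζ} m₀≤m γ<ζ ζ<δ →
            let (τ∈e , τ≮δ) , τ-least = τ-next m₀≤m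
            in (τ∈e , λ τ<ζ → τ≮δ (<-trans τ<ζ ζ<δ)) ,
               λ (x∈e , x≮ζ) → τ-least (x∈e , λ x<δ → x≮ζ
                 (≤-<-trans (proj₂ (proj₂ (gap m)) m₀≤m x∈e x<δ) (<-trans (θ<γ m) γ<ζ)))
          where
          gap : ∀ m → ∃ λ θ → θ < δ × (m₀ ℕ.≤ m → ∀ {x} → x ∈ e m ξ → x < δ → x ≤ θ)
          gap m with m₀ ℕₚ.≤? m
          ... | no m₀≰m = 𝟎 , 𝟎<δ , λ m₀≤m → contradiction m₀≤m m₀≰m
          ... | yes m₀≤m =
            -- If `e m ξ` were unbounded in `δ`, it would contain `δ` by closure, against `δ < τ`.
            let θ , θ<δ , bound = ¬sup⇒bounded λ sup →
                  ≤⇒≯ (proj₂ (τ-next m₀≤m) (IsClubIn.closed (club m ξ) δ<ξ 𝟎<δ sup , <-irrefl)) δ<τ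
            in θ , θ<δ , λ _ → bound

        opaque
          -- Induction on `ξ` along the first step `τ` towards `δ`. If `τ` = `δ`, then `η` is `ξ`;
          -- otherwise `skip-below` makes `τ` the first step towards all `ζ` close enough below `δ`.
          stable-walk : ∀ {ξ} → δ < ξ → StableWalk δ ξ
          stable-walk {ξ} = go (wellFounded ξ)
            where
            go : ∀ {ξ} → Acc _<_ ξ → δ < ξ → StableWalk δ ξ
            go {ξ} (accessible rs) δ<ξ with eventual-next δ<ξ
            ... | τ , m₀ , τ-next with ≮⇒≥ (proj₂ (proj₁ (τ-next ℕₚ.≤-refl)))
            ... | inj₂ refl = m₀ , ξ , 0 , 𝟎 , 𝟎<δ , λ m₀≤m →
                  proj₁ (proj₁ (τ-next m₀≤m)) , λ _ _ → refl
            ... | inj₁ δ<τ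
              with skip-below δ<ξ δ<τ τ-next
                 | go (rs (IsClubIn.subset (club m₀ ξ) (proj₁ (proj₁ (τ-next ℕₚ.≤-refl))))) δ<τ
            ... | γ₁ , γ₁<δ , skip | m₁ , η , k , γ₂ , γ₂<δ , reach
              with upper-bound {D = ↓ δ} γ₁<δ γ₂<δ
            ... | γ , γ<δ , γ₁≤γ , γ₂≤γ =
              m₀ ℕ.⊔ m₁ , η , suc k , γ , γ<δ , λ m₀⊔m₁≤m →
                let m₀≤m = ℕₚ.m⊔n≤o⇒m≤o m₀ m₁ m₀⊔m₁≤m
                    δ∈e , reach-η = reach (ℕₚ.m⊔n≤o⇒n≤o m₀ m₁ m₀⊔m₁≤m)
                in δ∈e , λ γ<ζ ζ<δ → trans (sym (walk-shift k)) (trans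
                  (cong (λ β → walk e _ _ β k)
                    (walk-suc {k = 0} refl (<-trans ζ<δ δ<ξ) (skip m₀≤m (≤-<-trans γ₁≤γ γ<ζ) ζ<δ)))
                  (reach-η (≤-<-trans γ₂≤γ γ<ζ) ζ<δ))

      -- The thresholds `m₀`, `α` and `θ` can be raised freely, so those for finitely many starting
      -- points combine by maxima. Only `θ′` may depend on `m` and `γ`.
      PassThrough : Ord → List Ord → Set ℓ
      PassThrough δ xs = ∃ λ m₀ → ∃ λ α → ∃ λ θ → α < μ × θ < δ ×
        (∀ {m γ} → m₀ ℕ.≤ m → γ ∈ C[ m ] δ → θ < γ → γ < δ → α ≤ cf γ → μ⟨ m ⟩ ⁺ < cf γ →
          ∃ λ θ′ → θ′ < γ × (∀ {ζ ξ} → θ′ < ζ → ζ < γ → ξ ∈ᴸ xs →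
            ∃ λ k → γ ≡ walk e m ζ ξ k))

      module _ (e-small : ∀ α m → e m α ≲ (↓ (cf α) ⟨⊎⟩ ↓ (μ⟨ m ⟩ ⁺)))
               (e-absorbs : ∀ α m {δ} → δ ∈ S → δ ∈ e m α → C[ m ] δ ⊆ e m α)
               {δ : Ord} (δ∈S : δ ∈ S) where

        opaque
          pass-through₁ : ∀ {ξ} → δ < ξ → PassThrough δ (ξ ∷ [])
          pass-through₁ {ξ} δ<ξ with stable-walk (ω<cf-δ δ∈S) δ<ξ
          ... | m₀ , η , k , θ , θ<δ , stable =
            -- The successor turns α ≤ cf γ into cf η < cf γ, as `≲⊎⇒bounded` requires.
            m₀ , succ (cf η) , θ , succ<μ (cf<μ (<⇒𝟎< δ<η)) , θ<δ , pass
            where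
            δ<η : δ < η
            δ<η = IsClubIn.subset (club m₀ η) (proj₁ (stable ℕₚ.≤-refl))

            pass : ∀ {m γ} → m₀ ℕ.≤ m → γ ∈ C[ m ] δ → θ < γ → γ < δ →
                   succ (cf η) ≤ cf γ → μ⟨ m ⟩ ⁺ < cf γ →
                   ∃ λ θ′ → θ′ < γ × (∀ {ζ ξ′} → θ′ < ζ → ζ < γ → ξ′ ∈ᴸ ξ ∷ [] →
                     ∃ λ k → γ ≡ walk e m ζ ξ′ k)
            pass {m} {γ} m₀≤m γ∈C[m] θ<γ γ<δ cf-η<cf-γ μ⁺<cf-γ
              with stable m₀≤m | ≲⊎⇒bounded (e-small η m) (<-≤-trans <succ cf-η<cf-γ) μ⁺<cf-γ
            ... | δ∈e , reach | θ₁ , θ₁<γ , bound with upper-bound {D = ↓ γ} θ₁<γ θ<γ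
            ... | θ′ , θ′<γ , θ₁≤θ′ , θ≤θ′ = θ′ , θ′<γ , λ { θ′<ζ ζ<γ (here refl) →
              suc k , sym (walk-suc {k = k}
                (reach (≤-<-trans θ≤θ′ θ′<ζ) (<-trans ζ<γ γ<δ))
                (<-trans ζ<γ (<-trans γ<δ δ<η))
                -- `γ` is the least element of `e m η` from `ζ` on: absorption puts it there, and
                -- smaller elements are at most `θ₁`, hence below `ζ`.
                ( (e-absorbs η m δ∈S δ∈e γ∈C[m] , λ γ<ζ → <-irrefl (<-trans γ<ζ ζ<γ))
                , λ (x∈e , x≮ζ) → ≮⇒≥ λ x<γ →
                    x≮ζ (≤-<-trans (≤-trans (bound x∈e x<γ) θ₁≤θ′) θ′<ζ))) }

        opaque
          pass-through : ∀ {xs} → All (δ <_) xs → PassThrough δ xs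
          pass-through [] = 0 , 𝟎 , 𝟎 , 𝟎<μ , 𝟎<δ (ω<cf-δ δ∈S) ,
            λ _ _ 𝟎<γ _ _ _ → 𝟎 , 𝟎<γ , λ _ _ ()
          pass-through (δ<ξ ∷ δ<xs) with pass-through₁ δ<ξ | pass-through δ<xs
          ... | m₁ , α₁ , θ₁ , α₁<μ , θ₁<δ , pass₁ | m₂ , α₂ , θ₂ , α₂<μ , θ₂<δ , pass₂
            with upper-bound {D = ↓ μ} α₁<μ α₂<μ | upper-bound {D = ↓ δ} θ₁<δ θ₂<δ
          ... | α , α<μ , α₁≤α , α₂≤α | θ , θ<δ , θ₁≤θ , θ₂≤θ =
            m₁ ℕ.⊔ m₂ , α , θ , α<μ , θ<δ , λ m₁⊔m₂≤m γ∈C[m] θ<γ γ<δ α≤cf-γ μ⁺<cf-γ →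
              let φ₁ , φ₁<γ , through₁ = pass₁ (ℕₚ.m⊔n≤o⇒m≤o m₁ m₂ m₁⊔m₂≤m) γ∈C[m]
                    (≤-<-trans θ₁≤θ θ<γ) γ<δ (≤-trans α₁≤α α≤cf-γ) μ⁺<cf-γ
                  φ₂ , φ₂<γ , through₂ = pass₂ (ℕₚ.m⊔n≤o⇒n≤o m₁ m₂ m₁⊔m₂≤m) γ∈C[m]
                    (≤-<-trans θ₂≤θ θ<γ) γ<δ (≤-trans α₂≤α α≤cf-γ) μ⁺<cf-γ
                  φ , φ<γ , φ₁≤φ , φ₂≤φ = upper-bound {D = ↓ _} φ₁<γ φ₂<γ
              in φ , φ<γ , λ
                { φ<ζ ζ<γ (here ξ≡)   → through₁ (≤-<-trans φ₁≤φ φ<ζ) ζ<γ (here ξ≡)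
                ; φ<ζ ζ<γ (there ξ∈xs) → through₂ (≤-<-trans φ₂≤φ φ<ζ) ζ<γ ξ∈xs
                }

    -- Finding members of the disjoint family in given intervals.

    module _ {t : Ord → List Ord} (t-disjoint : ∀ {α β} → α ≢ β → Disjoint (t α) (t β)) where

      index : Ord → Ord
      index ζ = min λ α → ζ ∈ᴸ t α

      index-spec : ∀ {ζ α} → ζ ∈ᴸ t α → index ζ ≡ α
      index-spec ζ∈tα = min-unique (ζ∈tα , λ ζ∈tβ →
        inj₂ (by-contradiction λ α≢β → t-disjoint α≢β (ζ∈tα , ζ∈tβ)))

      -- If α is closed under the index map, then no t β with β ≥ α meets α.
      opaque
        t-above : ∀ δ → ∃ λ α → δ < α × All (δ <_) (t α)
        t-above δ with IsClubIn.unbounded (closure-club index) {succ δ} tt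
        ... | α , closed , δ+1≤α = α , δ<α , All.tabulate λ ζ∈tα → ≰⇒> λ ζ≤δ →
          <-irrefl (subst (_< α) (index-spec ζ∈tα) (closed (≤-<-trans ζ≤δ δ<α)))
          where
          δ<α : δ < α
          δ<α = <-≤-trans <succ δ+1≤α

      opaque
        list-bounded : ∀ xs → ∃ λ β → All (_< β) xs
        list-bounded [] = 𝟎 , []
        list-bounded (x ∷ xs) with list-bounded xs
        ... | β , xs<β with upper-bound {D = U} {succ x} {β} tt tt
        ... | γ , _ , x+1≤γ , β≤γ =
          γ , <-≤-trans <succ x+1≤γ ∷ All.map (λ y<β → <-≤-trans y<β β≤γ) xs<β

      opaque
        t-between : ∀ ζ → ∃ λ γ → ∃ λ α → α < γ × All (λ x → ζ < x × x < γ) (t α)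
        t-between ζ with t-above ζ
        ... | α , _ , ζ<tα with list-bounded (α ∷ t α)
        ... | γ , α<γ ∷ tα<γ = γ , α , α<γ , All.zip (ζ<tα , tα<γ)

      -- For each `ζ` below a closure point `γ` of this function, some whole `t α` with `α < γ` lies
      -- strictly between `ζ` and `γ`.
      capture : Ord → Ord
      capture ζ = proj₁ (t-between ζ)

      -- The exceptional set belongs to the ideal.

      module _ {e : ℕ → Ord → Pred Ord ℓ} (e-seq : IsGeneralizedCSequence e)
               (e-small : ∀ α m → e m α ≲ (↓ (cf α) ⟨⊎⟩ ↓ (μ⟨ m ⟩ ⁺)))
               (e-absorbs : ∀ α m {δ} → δ ∈ S → δ ∈ e m α → C[ m ] δ ⊆ e m α) where

        IsPassedThrough : Pred Ord ℓ
        IsPassedThrough γ = ∃ λ α → ∃ λ β → ∃ λ m → α < β ×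
          (∀ {ζ ξ} → ζ ∈ᴸ t α → ξ ∈ᴸ t β → ζ < ξ × (∃ λ k → γ ≡ walk e m ζ ξ k))

        eventually-passed-through : ∀ {δ} → δ ∈ S →
          ∃ λ α → ∃ λ θ → α < μ × θ < δ ×
            (∀ {γ} → γ ∈ IsClosedUnder capture → γ ∈ nacc δ (C δ) → α ≤ cf γ → θ ≤ γ →
              IsPassedThrough γ)
        eventually-passed-through {δ} δ∈S with t-above δ
        ... | β , δ<β , δ<tβ with pass-through e-seq e-small e-absorbs δ∈S δ<tβ
        ... | m₀ , α₁ , θ₁ , α₁<μ , θ₁<δ , pass
          with upper-bound {D = ↓ μ} α₁<μ (succ<μ (μᵢ⁺<μ m₀))
             | upper-bound {D = ↓ δ} θ₁<δ (IsClubIn.subset (c⁰-club δ∈S) (c⁰∈ran δ∈S 𝟎<σ))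
        ... | α , α<μ , α₁≤α , μ⁺<α | θ , θ<δ , θ₁≤θ , c𝟎≤θ =
          -- A point outside the ideal's generator is only known to be at least the second
          -- parameter; the successor makes it exceed `θ`.
          α , succ θ , α<μ , succ<δ δ∈S θ<δ , passed
          where
          passed : ∀ {γ} → γ ∈ IsClosedUnder capture → γ ∈ nacc δ (C δ) →
                   α ≤ cf γ → succ θ ≤ γ → IsPassedThrough γ
          passed {γ} closed γ∈nacc α≤cf-γ θ<γ
            with IsClubIn.subset (C-club δ∈S) (proj₁ γ∈nacc)
               | nacc⇒∈I δ∈S γ∈nacc (≤-<-trans c𝟎≤θ (<-≤-trans <succ θ<γ))
          ... | γ<δ | ε , n , ε<σ , γ∈I
            -- The maximum is large enough both for `pass` and for `C[_]` to contain `γ`.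
            with pass {m₀ ℕ.⊔ n} (ℕₚ.m≤m⊔n m₀ n)
                   (inj₂ (ε , n , ε<σ , ℕₚ.m≤n⊔m m₀ n , proj₁ γ∈nacc , γ∈I))
                   (≤-<-trans θ₁≤θ (<-≤-trans <succ θ<γ)) γ<δ (≤-trans α₁≤α α≤cf-γ) μ⁺<cf-γ
            where
            μ⁺<cf-γ : μ⟨ m₀ ℕ.⊔ n ⟩ ⁺ < cf γ
            -- If the maximum is `m₀`, then `α` was chosen above `μ⟨ m₀ ⟩ ⁺`; if it is `n`, then `γ`
            -- is a non-accumulation point in `I δ ε n`.
            μ⁺<cf-γ = [ (λ eq → subst (λ m → μ⟨ m ⟩ ⁺ < cf γ) (sym eq)
                          (<-≤-trans (<-≤-trans <succ μ⁺<α) α≤cf-γ))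
                      , (λ eq → subst (λ m → μ⟨ m ⟩ ⁺ < cf γ) (sym eq)
                          (nacc-cf δ∈S ε<σ n (γ∈nacc , γ∈I)))
                      ]′ (ℕₚ.⊔-sel m₀ n)
          ... | θ′ , θ′<γ , through with proj₂ (t-between θ′) | closed θ′<γ
          ... | α′ , α′<φ , tα′ | φ<γ =
            α′ , β , m₀ ℕ.⊔ n , <-trans (<-trans α′<φ φ<γ) (<-trans γ<δ δ<β) , λ {ζ} {ξ} ζ∈ ξ∈ →
              let θ′<ζ , ζ<φ = All.lookup tα′ ζ∈
                  ζ<γ = <-trans ζ<φ φ<γ
              in <-trans (<-trans ζ<γ γ<δ) (All.lookup δ<tβ ξ∈) , through θ′<ζ ζ<γ ξ∈

        -- For each `δ` a single generator suffices: a point of `C δ` outside it is a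
        -- non-accumulation point, at least `θ`, of cofinality at least `α`.
        almost-all-passed-through : (¬_ ∘ IsPassedThrough) ∈ idₚ
        almost-all-passed-through = IsClosedUnder capture , closure-club capture ,
          λ (δ∈S , _) →
            let α , θ , α<μ , θ<δ , passed = eventually-passed-through δ∈S
            in (α , θ) ∷ [] , (α<μ , θ<δ) ∷ [] , λ (¬passed , closed , γ∈C) →
              here (γ∈C , by-contradiction λ ¬small → ¬passed (passed closed
                (γ∈C , ¬small ∘ inj₁)
                (≮⇒≥ (¬small ∘ inj₂ ∘ inj₁))
                (≮⇒≥ (¬small ∘ inj₂ ∘ inj₂))))

theorem6p1 : (em : ∀ {a} → ExcludedMiddle a) → ∀ {ℓ} (L : WellOrder ℓ) →
  let open WellOrder L
      open Ordinals em L in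
  (𝒮 : Setting) →
  let open Setting 𝒮 in
  (e : ℕ → Ord → Pred Ord ℓ) → IsGeneralizedCSequence e →
  (∀ α m → e m α ≲ (↓ (cf α) ⟨⊎⟩ ↓ (μ⟨ m ⟩ ⁺))) →
  (∀ α m {δ} → δ ∈ S → δ ∈ e m α → C[ m ] δ ⊆ e m α) →
  (t : Ord → List Ord) → (∀ {α β} → α ≢ β → Disjoint (t α) (t β)) →
  (λ β* → ¬ (∃ λ α → ∃ λ β → ∃ λ m → α < β ×
    (∀ {ζ ξ} → ζ ∈ᴸ t α → ξ ∈ᴸ t β →
      ζ < ξ × (∃ λ k → β* ≡ walk e m ζ ξ k)))) ∈ idₚ
theorem6p1 em L 𝒮 e e-seq e-small e-absorbs t t-disjoint =
  almost-all-passed-through em L 𝒮 t-disjoint e-seq e-small e-absorbs
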